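{- Let $\Delta$ be a pure simplicial complex of dimension $d\ge 1$. (a) If $\Delta$ is E-chordal, then $\Delta$ is vertex-chordal. (b) If $\Delta$ is mid-chordal, then $\Delta$ is weakly-vertex-chordal. (c) If $\Delta$ is very-weakly-chordal, then $\Delta$ is weakly-ridge-chordal.
   Context: Simplicial complexes are finite. A vertex labeling of a complex with $n$ vertices is a bijection of its vertices with $[n]$; $\max F$ is the largest label in $F$; the size of a face is its number of vertices. Two faces of the same dimension $k$ are adjacent if their intersection has dimension $k-1$. $\Delta$ is: - E-chordal, if it has a labeling such that for every two facets $F\ne G$ with the same size and same maximum, every subset $H\subseteq F\cup G$ with $|H|=|F|$ is a face of $\Delta$; - mid-chordal, if it has a labeling such that for every two facets $F\neq G$ with the same size and same maximum, $\Delta$ contains every $2$-element subset $e$ of $(F\cup G)\setminus\{\max F\}$ and, for each such $e$, some face $H_e$ with $|H_e|=|F|$ and $e\subseteq H_e\subseteq (F\cup G)\setminus\{\max F\}$; - very-weakly-chordal, if it has a labeling such that for every two adjacent facets $F\ne G$ with the same size and same maximum, $(F\cup G)\setminus\{\max F\}$ is a face of $\Delta$. A $t$-clique of a complex $\Gamma$ is a set $X$ of vertices such that any $k+1\le t+1$ vertices of $X$ span a $k$-face of $\Gamma$. A face of $\Gamma$ is $t$-simplicial if the vertices of its star in $\Gamma$ form a $t$-clique of $\Gamma$. Deleting above a face $F$ of $\Gamma$ means passing to the complex $\operatorname{abdel}(F,\Gamma)$ whose facets are the facets of $\Gamma$ not containing $F$. The empty set has dimension $-1$. For $0\le j<d$,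 a $d$-dimensional complex $\Delta$ is $j$-face-chordal (resp. weakly-$j$-face-chordal) if it can be reduced to a complex of dimension $\le j$ by repeatedly deleting above a $j$-face that is $d$-simplicial (resp. $1$-simplicial) in the current complex (here $d$ is always the dimension of the original $\Delta$). Vertex-chordal means $0$-face-chordal, weakly-vertex-chordal means weakly-$0$-face-chordal, and weakly-ridge-chordal means weakly-$(d-1)$-face-chordal. -}

module Defs where

open import Data.Bool.Properties using () renaming (_≟_ to _≟ᵇ_)
open import Data.Fin.Base as Fin using (Fin)
open import Data.Fin.Subset
  using (Subset; _∈_; _⊆_; _⊈_; _∪_; _∩_; _-_; ⁅_⁆; ∣_∣; Lift)
open import Data.Fin.Subset.Properties using (_⊆?_; anySubset?; ⊆-trans)
open import Data.Nat.Base using (ℕ; suc; _∸_; _≤_; _<_)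
open import Data.Product.Base using (_×_; _,_; ∃-syntax)
open import Data.Refinement using (Refinement; Refinement-syntax; value)
open import Data.Vec.Properties using (≡-dec)
open import Function.Bundles using (_⤖_; module Bijection)
open import Level using (0ℓ)
open import Relation.Binary.PropositionalEquality using (_≡_; _≢_)
open import Relation.Nullary.Decidable
  using (_×-dec_; ¬?; map′; decidable-stable)
open import Relation.Unary using (Pred; Decidable)

-- The elements of Fin n are the potential vertices: the actual vertices are
-- those whose singleton is a face.  The void complex, without even the empty
-- face, is allowed, since deleting above a face may leave no facets.
record SimplicialComplex (n : ℕ) : Set₁ where
  field
    Face   : Pred (Subset n) 0ℓ
    face?  : Decidable Face
    closed : ∀ {F G} → F ⊆ G → Face G → Face F

open SimplicialComplex public

private
  variable
    n : ℕ

-- The proof of being a vertex is irrelevant, so equality of vertices is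
-- equality in Fin n.
Vertex : SimplicialComplex n → Set
Vertex {n} Δ = [ v ∈ Fin n ∣ Face Δ ⁅ v ⁆ ]

Facet : SimplicialComplex n → Pred (Subset n) 0ℓ
Facet Δ F = Face Δ F × (∀ G → Face Δ G → F ⊆ G → F ≡ G)

facet? : (Δ : SimplicialComplex n) → Decidable (Facet Δ)
facet? Δ F = face? Δ F ×-dec
  map′ (λ none G G∈Δ F⊆G → decidable-stable (≡-dec _≟ᵇ_ F G)
         (λ F≢G → none (G , G∈Δ , (λ {x} → F⊆G {x}) , F≢G)))
       (λ { maximal (G , G∈Δ , F⊆G , F≢G) → F≢G (maximal G G∈Δ (λ {x} → F⊆G {x})) })
       (¬? (anySubset? λ G →
              face? Δ G ×-dec (F ⊆? G) ×-dec ¬? (≡-dec _≟ᵇ_ F G)))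

-- A face of size s has dimension s - 1.
DimAtMost : ℕ → SimplicialComplex n → Set
DimAtMost d Δ = ∀ F → Face Δ F → ∣ F ∣ ≤ suc d

HasDim : ℕ → SimplicialComplex n → Set
HasDim d Δ = (∃[ F ] Face Δ F × ∣ F ∣ ≡ suc d) × DimAtMost d Δ

Pure : SimplicialComplex n → Set
Pure Δ = ∀ F G → Facet Δ F → Facet Δ G → ∣ F ∣ ≡ ∣ G ∣

-- Labels start at 0.  The number k is necessarily the number of vertices.
Labeling : SimplicialComplex n → Set
Labeling Δ = ∃[ k ] (Vertex Δ ⤖ Fin k)

-- IsMax Δ ℓ F m: the vertex m is the one carrying the largest label in F.
IsMax : (Δ : SimplicialComplex n) → Labeling Δ → Subset n → Vertex Δ → Set
IsMax Δ (_ , ℓ) F m =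
  value m ∈ F × (∀ (v : Vertex Δ) → value v ∈ F → to v Fin.≤ to m)
  where open Bijection ℓ using (to)

Adjacent : Subset n → Subset n → Set
Adjacent F G = ∣ F ∣ ≡ ∣ G ∣ × suc ∣ F ∩ G ∣ ≡ ∣ F ∣

EChordal : SimplicialComplex n → Set
EChordal Δ = ∃[ ℓ ] ∀ F G → Facet Δ F → Facet Δ G → F ≢ G → ∣ F ∣ ≡ ∣ G ∣ →
  ∀ m → IsMax Δ ℓ F m → IsMax Δ ℓ G m →
  ∀ H → H ⊆ F ∪ G → ∣ H ∣ ≡ ∣ F ∣ → Face Δ H

MidChordal : SimplicialComplex n → Set
MidChordal Δ = ∃[ ℓ ] ∀ F G → Facet Δ F → Facet Δ G → F ≢ G → ∣ F ∣ ≡ ∣ G ∣ →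
  ∀ m → IsMax Δ ℓ F m → IsMax Δ ℓ G m →
  ∀ e → e ⊆ (F ∪ G) - value m → ∣ e ∣ ≡ 2 →
  Face Δ e ×
  (∃[ H ] Face Δ H × ∣ H ∣ ≡ ∣ F ∣ × e ⊆ H × H ⊆ (F ∪ G) - value m)

VeryWeaklyChordal : SimplicialComplex n → Set
VeryWeaklyChordal Δ = ∃[ ℓ ] ∀ F G → Facet Δ F → Facet Δ G → F ≢ G →
  Adjacent F G → ∣ F ∣ ≡ ∣ G ∣ →
  ∀ m → IsMax Δ ℓ F m → IsMax Δ ℓ G m →
  Face Δ ((F ∪ G) - value m)

-- Lift X H says that all elements of H lie in X.
Clique : ℕ → SimplicialComplex n → Pred (Fin n) 0ℓ → Set
Clique t Γ X = (∀ v → X v → Face Γ ⁅ v ⁆) ×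
  (∀ k → k ≤ t → ∀ H → Lift X H → ∣ H ∣ ≡ suc k → Face Γ H)

-- The closed star: faces of faces containing F.
Star : SimplicialComplex n → Subset n → Pred (Subset n) 0ℓ
Star Γ F G = Face Γ (F ∪ G)

Simplicial : ℕ → SimplicialComplex n → Subset n → Set
Simplicial t Γ F = Clique t Γ (λ v → Star Γ F ⁅ v ⁆)

abdel : Subset n → SimplicialComplex n → SimplicialComplex n
abdel F Γ = record
  { Face   = λ H → ∃[ G ] Facet Γ G × F ⊈ G × H ⊆ G
  ; face?  = λ H → anySubset? λ G →
               facet? Γ G ×-dec ¬? (F ⊆? G) ×-dec (H ⊆? G)
  ; closed = λ { H⊆K (G , G-facet , F⊈G , K⊆G) →
               G , G-facet , F⊈G , ⊆-trans (λ {x} → H⊆K {x}) (λ {x} → K⊆G {x}) }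
  }

data Reducible (t j : ℕ) {n : ℕ} (Γ : SimplicialComplex n) : Set where
  done   : DimAtMost j Γ → Reducible t j Γ
  delete : ∀ F → Face Γ F → ∣ F ∣ ≡ suc j → Simplicial t Γ F →
           Reducible t j (abdel F Γ) → Reducible t j Γ

FaceChordal : (d j : ℕ) → SimplicialComplex n → Set
FaceChordal d j Δ = j < d × HasDim d Δ × Reducible d j Δ

WeaklyFaceChordal : (d j : ℕ) → SimplicialComplex n → Set
WeaklyFaceChordal d j Δ = j < d × HasDim d Δ × Reducible 1 j Δ

VertexChordal : (d : ℕ) → SimplicialComplex n → Set
VertexChordal d = FaceChordal d 0

WeaklyVertexChordal : (d : ℕ) → SimplicialComplex n → Set
WeaklyVertexChordal d = WeaklyFaceChordal d 0

WeaklyRidgeChordal : (d : ℕ) → SimplicialComplex n → Set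
WeaklyRidgeChordal d = WeaklyFaceChordal d (d ∸ 1)

{-# OPTIONS --safe #-}
-- Vertices are eliminated in decreasing order of label.  Let m carry the
-- largest label in the current complex; then any two facets through m have the
-- same maximum.  In (a) and (b) the vertex m itself is simplicial and is
-- deleted; in (c) every ridge containing m is 1-simplicial, and such ridges are
-- deleted until no facet contains m.  Each chordality condition survives since
-- the faces it asks for later on avoid m.
module Submission where

open import Defs
open import Data.Bool.Base using (Bool)
open import Data.Bool.Properties using () renaming (_≟_ to _≟ᵇ_)
open import Data.Fin.Base as Fin using (Fin; zero; suc)
open import Data.Fin.Properties as Fin using (any?)
open import Data.Fin.Subset
  using (Subset; inside; outside; _∈_; _∉_; _⊆_; _⊈_; _⊂_; _∪_; _∩_; _-_; ⊥; ⁅_⁆; ∣_∣; Lift; Nonempty)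
open import Data.Fin.Subset.Properties
open import Data.Irrelevant using ([_])
open import Data.List.Base using (List; []; _∷_; length; filter; cartesianProductWith)
open import Data.List.Membership.Propositional using (lose) renaming (_∈_ to _∈ᴸ_)
open import Data.List.Membership.Propositional.Properties
  using (∈-filter⁺; ∈-cartesianProductWith⁺)
open import Data.List.Properties using (filter-notAll)
open import Data.List.Relation.Unary.Any using (here; there)
open import Data.Nat.Base using (ℕ; zero; suc; _≤_; _<_; _+_; _∸_; z≤n; s≤s)
open import Data.Nat.Properties
open import Data.Product.Base using (_×_; _,_; proj₁; proj₂; ∃-syntax)
open import Data.Refinement using (_,_; value)
open import Data.Sum.Base using (_⊎_; inj₁; inj₂; [_,_]′)
open import Data.Vec.Base using ([]; _∷_; here; there)
open import Data.Vec.Properties using (≡-dec)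
open import Function.Base using (_∘_)
open import Function.Bundles using (module Bijection; module Inverse)
open import Function.Properties.Bijection using (⤖⇒↔)
open import Level using (0ℓ)
open import Relation.Binary.Definitions using (DecidableEquality)
open import Relation.Binary.PropositionalEquality
  using (_≡_; _≢_; refl; sym; trans; cong; subst; subst₂)
open import Relation.Nullary using (¬_; yes; no; contradiction)
open import Relation.Nullary.Decidable using (_×-dec_; ¬?; decidable-stable)
open import Relation.Unary using (Pred; Decidable)

private
  variable
    n : ℕ
    x y : Fin n
    p q : Subset n

-- Finite subsets

_≟ˢ_ : DecidableEquality (Subset n)
_≟ˢ_ = ≡-dec _≟ᵇ_

⁅x⁆⊆p : x ∈ p → ⁅ x ⁆ ⊆ p
⁅x⁆⊆p {x = x} {p = p} x∈p y∈⁅x⁆ = subst (_∈ p) (sym (x∈⁅y⁆⇒x≡y x y∈⁅x⁆)) x∈p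

∪-least : {r : Subset n} → p ⊆ r → q ⊆ r → p ∪ q ⊆ r
∪-least {p = p} {q = q} p⊆r q⊆r = [ p⊆r , q⊆r ]′ ∘ x∈p∪q⁻ p q

⁅x⁆∪⁅y⁆⊆p : x ∈ p → y ∈ p → ⁅ x ⁆ ∪ ⁅ y ⁆ ⊆ p
⁅x⁆∪⁅y⁆⊆p x∈p y∈p = ∪-least (⁅x⁆⊆p x∈p) (⁅x⁆⊆p y∈p)

x∈⁅x⁆∪⁅y⁆ : (x y : Fin n) → x ∈ ⁅ x ⁆ ∪ ⁅ y ⁆
x∈⁅x⁆∪⁅y⁆ x y = p⊆p∪q ⁅ y ⁆ (x∈⁅x⁆ x)

y∈⁅x⁆∪⁅y⁆ : (x y : Fin n) → y ∈ ⁅ x ⁆ ∪ ⁅ y ⁆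
y∈⁅x⁆∪⁅y⁆ x y = q⊆p∪q ⁅ x ⁆ ⁅ y ⁆ (x∈⁅x⁆ y)

x∈p-y⁻ : (p : Subset n) (y : Fin n) → x ∈ p - y → x ∈ p × x ≢ y
x∈p-y⁻ p y x∈p-y = p─q⊆p p ⁅ y ⁆ x∈p-y , λ { refl → x∉p-x p y x∈p-y }
  where
  x∉p-x : (p : Subset n) (x : Fin n) → x ∉ p - x
  x∉p-x (inside  ∷ p) zero    ()
  x∉p-x (outside ∷ p) zero    ()
  x∉p-x (s       ∷ p) (suc x) (there x∈) = x∉p-x p x x∈

p-x⊆q∧x∈q⇒p⊆q : p - x ⊆ q → x ∈ q → p ⊆ q
p-x⊆q∧x∈q⇒p⊆q {x = x} p-x⊆q x∈q {y} y∈p with y Fin.≟ x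
... | yes refl = x∈q
... | no  y≢x  = p-x⊆q (x∈p∧x≢y⇒x∈p-y y∈p y≢x)

x∈p⇒suc∣p-x∣≡∣p∣ : x ∈ p → suc ∣ p - x ∣ ≡ ∣ p ∣
x∈p⇒suc∣p-x∣≡∣p∣ {p = _ ∷ p}       here      = cong (suc ∘ ∣_∣) (p─⊥≡p p)
x∈p⇒suc∣p-x∣≡∣p∣ {p = inside  ∷ _} (there x) = cong suc (x∈p⇒suc∣p-x∣≡∣p∣ x)
x∈p⇒suc∣p-x∣≡∣p∣ {p = outside ∷ _} (there x) = x∈p⇒suc∣p-x∣≡∣p∣ x

∣p∪⁅x⁆∣≤suc∣p∣ : (p : Subset n) (x : Fin n) → ∣ p ∪ ⁅ x ⁆ ∣ ≤ suc ∣ p ∣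
∣p∪⁅x⁆∣≤suc∣p∣ (inside  ∷ p) zero    =
  s≤s (≤-trans (≤-reflexive (cong ∣_∣ (∪-identityʳ p))) (n≤1+n ∣ p ∣))
∣p∪⁅x⁆∣≤suc∣p∣ (outside ∷ p) zero    = s≤s (≤-reflexive (cong ∣_∣ (∪-identityʳ p)))
∣p∪⁅x⁆∣≤suc∣p∣ (inside  ∷ p) (suc x) = s≤s (∣p∪⁅x⁆∣≤suc∣p∣ p x)
∣p∪⁅x⁆∣≤suc∣p∣ (outside ∷ p) (suc x) = ∣p∪⁅x⁆∣≤suc∣p∣ p x

x∉p⇒∣p∪⁅x⁆∣≡suc∣p∣ : x ∉ p → ∣ p ∪ ⁅ x ⁆ ∣ ≡ suc ∣ p ∣
x∉p⇒∣p∪⁅x⁆∣≡suc∣p∣ {x = x} {p = p} x∉p = ≤-antisym (∣p∪⁅x⁆∣≤suc∣p∣ p x)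
  (p⊂q⇒∣p∣<∣q∣ (p⊆p∪q ⁅ x ⁆ , x , q⊆p∪q p ⁅ x ⁆ (x∈⁅x⁆ x) , x∉p))

p⊈q⇒∃ : p ⊈ q → ∃[ x ] x ∈ p × x ∉ q
p⊈q⇒∃ {p = p} {q = q} p⊈q =
  decidable-stable (any? λ x → (x ∈? p) ×-dec ¬? (x ∈? q)) λ none →
    p⊈q λ {x} x∈p → decidable-stable (x ∈? q) λ x∉q → none (x , x∈p , x∉q)

∣p∣<∣q∣⇒∃ : ∣ p ∣ < ∣ q ∣ → ∃[ x ] x ∈ q × x ∉ p
∣p∣<∣q∣⇒∃ ∣p∣<∣q∣ = p⊈q⇒∃ λ q⊆p → <⇒≱ ∣p∣<∣q∣ (p⊆q⇒∣p∣≤∣q∣ q⊆p)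

0<∣p∣⇒Nonempty : {p : Subset n} → 0 < ∣ p ∣ → Nonempty p
0<∣p∣⇒Nonempty {n} {p} 0<∣p∣
  with x , x∈p , _ ← ∣p∣<∣q∣⇒∃ {p = ⊥} {q = p} (subst (_< ∣ p ∣) (sym (∣⊥∣≡0 n)) 0<∣p∣)
  = x , x∈p

x∈p⇒0<∣p∣ : x ∈ p → 0 < ∣ p ∣
x∈p⇒0<∣p∣ x∈p = ≤-trans (s≤s z≤n) (x∈p⇒∣p-x∣<∣p∣ x∈p)

p⊆q∧∣q∣≤∣p∣⇒p≡q : p ⊆ q → ∣ q ∣ ≤ ∣ p ∣ → p ≡ q
p⊆q∧∣q∣≤∣p∣⇒p≡q {p = p} {q = q} p⊆q ∣q∣≤∣p∣ = ⊆-antisym p⊆q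
  (decidable-stable (q ⊆? p) λ q⊈p →
    <⇒≱ (p⊂q⇒∣p∣<∣q∣ (p⊆q , p⊈q⇒∃ q⊈p)) ∣q∣≤∣p∣)

∣p∣≤1⇒x≡y : ∣ p ∣ ≤ 1 → x ∈ p → y ∈ p → x ≡ y
∣p∣≤1⇒x≡y {x = x} {y = y} ∣p∣≤1 x∈p y∈p = decidable-stable (x Fin.≟ y) λ x≢y →
  <⇒≱ (x∈p⇒0<∣p∣ (x∈p∧x≢y⇒x∈p-y x∈p x≢y))
    (≤-pred (≤-trans (x∈p⇒∣p-x∣<∣p∣ y∈p) ∣p∣≤1))

-- Singletons are covered by letting `y` equal `x`, which spares `clique₁` a case distinction.
∣p∣≤2⇒pair : ∣ p ∣ ≤ 2 → x ∈ p → ∃[ y ] y ∈ p × p ⊆ ⁅ x ⁆ ∪ ⁅ y ⁆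
∣p∣≤2⇒pair {p = p} {x = x} ∣p∣≤2 x∈p with nonempty? (p - x)
... | yes (y , y∈p-x) = y , proj₁ (x∈p-y⁻ p x y∈p-x) ,
  p-x⊆q∧x∈q⇒p⊆q (λ z∈p-x → subst (_∈ ⁅ x ⁆ ∪ ⁅ y ⁆) (∣p∣≤1⇒x≡y ∣p-x∣≤1 y∈p-x z∈p-x) (y∈⁅x⁆∪⁅y⁆ x y))
          (x∈⁅x⁆∪⁅y⁆ x y)
  where
  ∣p-x∣≤1 : ∣ p - x ∣ ≤ 1
  ∣p-x∣≤1 = ≤-pred (≤-trans (x∈p⇒∣p-x∣<∣p∣ x∈p) ∣p∣≤2)
... | no empty = x , x∈p ,
  p-x⊆q∧x∈q⇒p⊆q (λ {z} z∈p-x → contradiction (z , z∈p-x) empty) (x∈⁅x⁆∪⁅y⁆ x x)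

sides : List Bool
sides = inside ∷ outside ∷ []

∈-sides : ∀ s → s ∈ᴸ sides
∈-sides inside  = here refl
∈-sides outside = there (here refl)

-- The starting list of candidate faces whose shrinking makes the recursion in `reducible`
-- terminate.
subsets : ∀ n → List (Subset n)
subsets zero    = [] ∷ []
subsets (suc n) = cartesianProductWith _∷_ sides (subsets n)

∈-subsets : (p : Subset n) → p ∈ᴸ subsets n
∈-subsets []      = here refl
∈-subsets (s ∷ p) =
  ∈-cartesianProductWith⁺ _∷_ {xs = sides} (∈-sides s) (∈-subsets p)

greatest : ∀ {k} {P : Pred (Fin k) 0ℓ} → Decidable P →
  (∃[ i ] P i × (∀ j → P j → j Fin.≤ i)) ⊎ (∀ i → ¬ P i)
greatest {zero}  P? = inj₂ λ ()
greatest {suc k} P? with greatest (P? ∘ suc)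
... | inj₁ (i , Pi , i-max) = inj₁ (suc i , Pi , λ { zero _ → z≤n ; (suc j) Pj → s≤s (i-max j Pj) })
... | inj₂ none with P? zero
...   | yes P0 = inj₁ (zero , P0 , λ { zero _ → z≤n ; (suc j) Pj → contradiction Pj (none j) })
...   | no ¬P0 = inj₂ λ { zero → ¬P0 ; (suc j) → none j }

-- Simplicial complexes

Face-abdel⁻ : {Γ : SimplicialComplex n} {R H : Subset n} → Face (abdel R Γ) H → Face Γ H
Face-abdel⁻ {Γ = Γ} (_ , (G∈Γ , _) , _ , H⊆G) = closed Γ H⊆G G∈Γ

R∉abdel : {Γ : SimplicialComplex n} {R : Subset n} → ¬ Face (abdel R Γ) R
R∉abdel (_ , _ , R⊈G , R⊆G) = R⊈G R⊆G

facetAbove : (Γ : SimplicialComplex n) {F : Subset n} → Face Γ F → ∃[ G ] Facet Γ G × F ⊆ G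
facetAbove {n} Γ {F} F∈Γ = go n F F∈Γ (m≤n+m n ∣ F ∣)
  where
  -- `k` bounds the number of elements outside `F`; each strict enlargement lowers that number, and
  -- at zero no enlargement is possible.
  go : ∀ k F → Face Γ F → n ≤ ∣ F ∣ + k → ∃[ G ] Facet Γ G × F ⊆ G
  go k F F∈Γ n≤ with anySubset? (λ G → face? Γ G ×-dec (F ⊂? G))
  go k F F∈Γ n≤ | no none = F , (F∈Γ , maximal) , ⊆-refl
    where
    maximal : ∀ G → Face Γ G → F ⊆ G → F ≡ G
    maximal G G∈Γ F⊆G = ⊆-antisym F⊆G (decidable-stable (G ⊆? F) λ G⊈F →
      none (G , G∈Γ , F⊆G , p⊈q⇒∃ G⊈F))
  go zero F F∈Γ n≤ | yes (G , _ , F⊂G) = contradiction (p⊂q⇒∣p∣<∣q∣ F⊂G)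
    (≤⇒≯ (≤-trans (∣p∣≤n G) (subst (n ≤_) (+-identityʳ ∣ F ∣) n≤)))
  go (suc k) F F∈Γ n≤ | yes (G , G∈Γ , F⊂G)
    with K , K-facet , G⊆K ← go k G G∈Γ (≤-trans (subst (n ≤_) (+-suc ∣ F ∣ k) n≤)
           (+-monoˡ-≤ k (p⊂q⇒∣p∣<∣q∣ F⊂G)))
    = K , K-facet , ⊆-trans (proj₁ F⊂G) G⊆K

-- A set of size one or two lies in a pair with possibly equal ends, so the hypothesis, which admits
-- `u = v`, settles vertices and edges at once.
clique₁ : (Γ : SimplicialComplex n) {X : Pred (Fin n) 0ℓ} →
  (∀ {u v} → X u → X v → Face Γ (⁅ u ⁆ ∪ ⁅ v ⁆)) → Clique 1 Γ X
clique₁ Γ {X} edge = (λ v Xv → closed Γ (p⊆p∪q ⁅ v ⁆) (edge Xv Xv)) , clique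
  where
  clique : ∀ k → k ≤ 1 → ∀ H → Lift X H → ∣ H ∣ ≡ suc k → Face Γ H
  clique k k≤1 H X⊇H ∣H∣≡suck
    with u , u∈H ← 0<∣p∣⇒Nonempty {p = H} (subst (0 <_) (sym ∣H∣≡suck) (s≤s z≤n))
    with v , v∈H , H⊆uv ← ∣p∣≤2⇒pair (subst (_≤ 2) (sym ∣H∣≡suck) (s≤s k≤1)) u∈H
    = closed Γ H⊆uv (edge (X⊇H u∈H) (X⊇H v∈H))

-- "Pure of dimension d, or void", together with the inclusion in Δ.
record PureSub (d : ℕ) (Δ Γ : SimplicialComplex n) : Set where
  field
    included : ∀ {F} → Face Γ F → Face Δ F
    bounded  : DimAtMost d Γ
    extend   : ∀ {F} → Face Γ F → ∃[ G ] Face Γ G × ∣ G ∣ ≡ suc d × F ⊆ G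

  full⇒facet : ∀ {F} → Face Γ F → ∣ F ∣ ≡ suc d → Facet Γ F
  full⇒facet F∈Γ ∣F∣ = F∈Γ , λ G G∈Γ F⊆G →
    p⊆q∧∣q∣≤∣p∣⇒p≡q F⊆G (≤-trans (bounded G G∈Γ) (≤-reflexive (sym ∣F∣)))

  facet⇒full : ∀ {F} → Facet Γ F → ∣ F ∣ ≡ suc d
  facet⇒full (F∈Γ , maximal) with G , G∈Γ , ∣G∣ , F⊆G ← extend F∈Γ =
    trans (cong ∣_∣ (maximal G G∈Γ F⊆G)) ∣G∣

open PureSub

-- A facet above a face of size `suc d` has exactly that size by the dimension bound, and purity
-- carries the size over to every other facet.
pure⇒PureSub : ∀ {d} {Δ : SimplicialComplex n} → Pure Δ → HasDim d Δ → PureSub d Δ Δ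
pure⇒PureSub {d = d} {Δ} pure ((F₀ , F₀∈Δ , ∣F₀∣) , bound) = record
  { included = λ F∈Δ → F∈Δ
  ; bounded  = bound
  ; extend   = extend′
  }
  where
  extend′ : ∀ {F} → Face Δ F → ∃[ G ] Face Δ G × ∣ G ∣ ≡ suc d × F ⊆ G
  extend′ F∈Δ
    with G₀ , G₀-facet , F₀⊆G₀ ← facetAbove Δ F₀∈Δ
    with G , G-facet , F⊆G ← facetAbove Δ F∈Δ
    = G , proj₁ G-facet , trans (pure G G₀ G-facet G₀-facet) ∣G₀∣ , F⊆G
    where
    ∣G₀∣ : ∣ G₀ ∣ ≡ suc d
    ∣G₀∣ = ≤-antisym (bound G₀ (proj₁ G₀-facet)) (subst (_≤ _) ∣F₀∣ (p⊆q⇒∣p∣≤∣q∣ F₀⊆G₀))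

module _ {d : ℕ} {Δ Γ : SimplicialComplex n} (Γ-pure : PureSub d Δ Γ) {R : Subset n} where

  PureSub-abdel : PureSub d Δ (abdel R Γ)
  PureSub-abdel = record
    { included = included Γ-pure ∘ Face-abdel⁻ {Γ = Γ}
    ; bounded  = λ F → bounded Γ-pure F ∘ Face-abdel⁻ {Γ = Γ}
    ; extend   = λ { (G , G-facet , R⊈G , F⊆G) →
        G , (G , G-facet , R⊈G , ⊆-refl) , facet⇒full Γ-pure G-facet , F⊆G }
    }

  -- A face of full size is a facet, and missing a vertex of `R` it cannot contain `R`. This is how
  -- the faces demanded by a chordality condition survive a deletion.
  full-abdel⁺ : ∀ {H} → Face Γ H → ∣ H ∣ ≡ suc d → x ∈ R → x ∉ H → Face (abdel R Γ) H
  full-abdel⁺ {H = H} H∈Γ ∣H∣ x∈R x∉H =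
    H , full⇒facet Γ-pure H∈Γ ∣H∣ , (λ R⊆H → x∉H (R⊆H x∈R)) , ⊆-refl

x∉abdel-⁅x⁆ : {Γ : SimplicialComplex n} {H : Subset n} → Face (abdel ⁅ x ⁆ Γ) H → x ∉ H
x∉abdel-⁅x⁆ (_ , _ , x∉G , H⊆G) x∈H = x∉G (⁅x⁆⊆p (H⊆G x∈H))

-- Elimination along a fixed labeling of `Δ`.

module _ {d : ℕ} {Δ : SimplicialComplex n} (ℓ : Labeling Δ) where

  open Bijection (proj₂ ℓ) using (to; injective)
  open Inverse (⤖⇒↔ (proj₂ ℓ)) using (from; inverseˡ; inverseʳ)

  -- The labeling of `Δ` is kept while `Γ` shrinks; only the vertices still present in `Γ` compete.
  Top : SimplicialComplex n → Vertex Δ → Set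
  Top Γ m = Face Γ ⁅ value m ⁆ × (∀ v → Face Γ ⁅ value v ⁆ → to v Fin.≤ to m)

  -- Full size stands in for being a facet, and maxima refer to `Δ`. Thus `Γ` enters only through
  -- face membership, and rivals in a deletion are rivals in `Γ`.
  record Rivals (Γ : SimplicialComplex n) (F G : Subset n) (m : Vertex Δ) : Set where
    field
      F∈Γ  : Face Γ F
      G∈Γ  : Face Γ G
      ∣F∣  : ∣ F ∣ ≡ suc d
      ∣G∣  : ∣ G ∣ ≡ suc d
      F≢G  : F ≢ G
      maxF : IsMax Δ ℓ F m
      maxG : IsMax Δ ℓ G m

  module _ {Γ : SimplicialComplex n} (Γ-pure : PureSub d Δ Γ) where

    top? : (∃[ m ] Top Γ m) ⊎ (∀ (v : Vertex Δ) → ¬ Face Γ ⁅ value v ⁆)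
    top? with greatest (λ i → face? Γ ⁅ value (from i) ⁆)
    ... | inj₁ (i , i∈Γ , i-max) = inj₁ (from i , i∈Γ , λ v v∈Γ →
        subst (to v Fin.≤_) (sym (inverseˡ refl))
          (i-max (to v) (subst (λ u → Face Γ ⁅ value u ⁆) (sym (inverseʳ refl)) v∈Γ)))
    ... | inj₂ none = inj₂ λ v v∈Γ →
        none (to v) (subst (λ u → Face Γ ⁅ value u ⁆) (sym (inverseʳ refl)) v∈Γ)

    no-vertex⇒DimAtMost : ∀ {j} → (∀ (v : Vertex Δ) → ¬ Face Γ ⁅ value v ⁆) → DimAtMost j Γ
    no-vertex⇒DimAtMost none F F∈Γ = ≮⇒≥ λ j<∣F∣ →
      let x , x∈F = 0<∣p∣⇒Nonempty {p = F} (≤-trans (s≤s z≤n) j<∣F∣)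
          x∈Γ     = closed Γ (⁅x⁆⊆p x∈F) F∈Γ
      in none (x , [ included Γ-pure x∈Γ ]) x∈Γ

    module _ {m : Vertex Δ} (m-top : Top Γ m) where

      top⇒IsMax : ∀ {F} → Face Γ F → value m ∈ F → IsMax Δ ℓ F m
      top⇒IsMax F∈Γ m∈F = m∈F , λ v v∈F → proj₂ m-top v (closed Γ (⁅x⁆⊆p v∈F) F∈Γ)

      top⇒rivals : ∀ {F G} → Face Γ F → Face Γ G → ∣ F ∣ ≡ suc d → ∣ G ∣ ≡ suc d → F ≢ G →
        value m ∈ F → value m ∈ G → Rivals Γ F G m
      top⇒rivals F∈Γ G∈Γ ∣F∣ ∣G∣ F≢G m∈F m∈G = record
        { F∈Γ = F∈Γ ; G∈Γ = G∈Γ ; ∣F∣ = ∣F∣ ; ∣G∣ = ∣G∣ ; F≢G = F≢G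
        ; maxF = top⇒IsMax F∈Γ m∈F ; maxG = top⇒IsMax G∈Γ m∈G }

      -- Each of the two vertices bounds the label of the other, and labels are injective.
      top∈max⇒≡ : ∀ {F m′} → Face Γ F → IsMax Δ ℓ F m′ → value m ∈ F → m ≡ m′
      top∈max⇒≡ {m′ = m′} F∈Γ (m′∈F , m′-max) m∈F = injective (Fin.≤-antisym
        (m′-max m m∈F) (proj₂ m-top m′ (closed Γ (⁅x⁆⊆p m′∈F) F∈Γ)))

  Rivals-abdel⁻ : ∀ {Γ R F G m} → Rivals (abdel R Γ) F G m → Rivals Γ F G m
  Rivals-abdel⁻ {Γ} r = record
    { F∈Γ = Face-abdel⁻ {Γ = Γ} F∈Γ ; G∈Γ = Face-abdel⁻ {Γ = Γ} G∈Γ ; ∣F∣ = ∣F∣ ; ∣G∣ = ∣G∣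
    ; F≢G = F≢G ; maxF = maxF ; maxG = maxG }
    where open Rivals r

  -- Common induction for the three cases, with `I` the condition to be preserved. It terminates
  -- because `R` is a face of `Γ` but not of `abdel R Γ`, so filtering drops at least one candidate.
  -- It stops when no vertex is left, and then every bound `j` on the dimension holds.
  reducible : ∀ {t j} (I : SimplicialComplex n → Set) →
    (∀ {Γ m} → PureSub d Δ Γ → Top Γ m → I Γ →
      ∃[ R ] Face Γ R × ∣ R ∣ ≡ suc j × Simplicial t Γ R × I (abdel R Γ)) →
    ∀ {Γ} → PureSub d Δ Γ → I Γ → Reducible t j Γ
  reducible {t} {j} I step = λ Γ-pure IΓ →
      go (suc (length (subsets n))) (subsets n) ≤-refl (λ {F} _ → ∈-subsets F) Γ-pure IΓ
    where
    go : ∀ k {Γ} (Fs : List (Subset n)) → length Fs < k → (∀ {F} → Face Γ F → F ∈ᴸ Fs) →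
      PureSub d Δ Γ → I Γ → Reducible t j Γ
    go (suc k) {Γ} Fs (s≤s ∣Fs∣≤k) listed Γ-pure IΓ with top? Γ-pure
    ... | inj₂ none = done (no-vertex⇒DimAtMost Γ-pure none)
    ... | inj₁ (m , m-top) with R , R∈Γ , ∣R∣ , R-simplicial , I′ ← step Γ-pure m-top IΓ =
      delete R R∈Γ ∣R∣ R-simplicial
        (go k (filter (face? (abdel R Γ)) Fs)
          (≤-trans (filter-notAll (face? (abdel R Γ)) Fs
                     (lose (listed R∈Γ) (R∉abdel {Γ = Γ} {R})))
            ∣Fs∣≤k)
          (λ F∈ → ∈-filter⁺ (face? (abdel R Γ)) (listed (Face-abdel⁻ {Γ = Γ} F∈)) F∈)
          (PureSub-abdel Γ-pure) I′)

  -- E-chordal complexes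

  EClosed : SimplicialComplex n → Set
  EClosed Γ = ∀ {F G m} → Rivals Γ F G m → ∀ {H} → H ⊆ F ∪ G → ∣ H ∣ ≡ suc d → Face Γ H

  module _ {Γ : SimplicialComplex n} (Γ-pure : PureSub d Δ Γ)
           {m : Vertex Δ} (m-top : Top Γ m) (e-closed : EClosed Γ) where

    -- If F covers all of B but b, exchanging in F some vertex outside B ∪ {m}
    -- for b gives a facet: it lies in F ∪ G for any facet G through m and b.
    star-cover : ∀ {k} B → ∣ B ∣ ≡ k → k ≤ d → Lift (λ v → Star Γ ⁅ value m ⁆ ⁅ v ⁆) B →
      ∃[ F ] Face Γ F × ∣ F ∣ ≡ suc d × value m ∈ F × B ⊆ F
    star-cover {zero} B ∣B∣ _ _ with F , F∈Γ , ∣F∣ , m⊆F ← extend Γ-pure (proj₁ m-top) =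
      F , F∈Γ , ∣F∣ , m⊆F (x∈⁅x⁆ (value m)) ,
      λ x∈B → contradiction (x∈p⇒0<∣p∣ x∈B) (≤⇒≯ (≤-reflexive ∣B∣))
    star-cover {suc k} B ∣B∣ k<d B⊆star
      with b , b∈B ← 0<∣p∣⇒Nonempty {p = B} (subst (0 <_) (sym ∣B∣) (s≤s z≤n))
      with ∣B-b∣ ← suc-injective (trans (x∈p⇒suc∣p-x∣≡∣p∣ b∈B) ∣B∣)
      with F , F∈Γ , ∣F∣ , m∈F , B-b⊆F ←
        star-cover (B - b) ∣B-b∣ (<⇒≤ k<d) (B⊆star ∘ proj₁ ∘ x∈p-y⁻ B b)
      with b ∈? F
    ... | yes b∈F = F , F∈Γ , ∣F∣ , m∈F , p-x⊆q∧x∈q⇒p⊆q B-b⊆F b∈F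
    ... | no  b∉F
      -- `B - b` together with `m` has at most `suc k ≤ d` elements, while `F` has `suc d`. Since
      -- `b ∉ F`, the vertex `x` found is outside all of `B`.
      with x , x∈F , x∉ ← ∣p∣<∣q∣⇒∃ {p = (B - b) ∪ ⁅ value m ⁆} {q = F}
             (subst₂ _<_ refl (sym ∣F∣) (s≤s
               (≤-trans (∣p∪⁅x⁆∣≤suc∣p∣ (B - b) (value m)) (subst (_< d) (sym ∣B-b∣) k<d))))
      with G , G∈Γ , ∣G∣ , mb⊆G ← extend Γ-pure (B⊆star b∈B)
      = H , e-closed rivals H⊆F∪G ∣H∣ , ∣H∣ , p⊆p∪q ⁅ b ⁆ m∈F-x ,
        p-x⊆q∧x∈q⇒p⊆q (λ y∈B-b → p⊆p∪q ⁅ b ⁆ (x∈p∧x≢y⇒x∈p-y (B-b⊆F y∈B-b)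
                  λ { refl → x∉ (p⊆p∪q ⁅ value m ⁆ y∈B-b) }))
                (q⊆p∪q (F - x) ⁅ b ⁆ (x∈⁅x⁆ b))
      where
      H = (F - x) ∪ ⁅ b ⁆

      b∈G = mb⊆G (y∈⁅x⁆∪⁅y⁆ (value m) b)

      rivals : Rivals Γ F G m
      rivals = top⇒rivals Γ-pure m-top F∈Γ G∈Γ ∣F∣ ∣G∣ (λ { refl → b∉F b∈G })
        m∈F (mb⊆G (x∈⁅x⁆∪⁅y⁆ (value m) b))

      ∣H∣ : ∣ H ∣ ≡ suc d
      ∣H∣ = trans (x∉p⇒∣p∪⁅x⁆∣≡suc∣p∣ (b∉F ∘ proj₁ ∘ x∈p-y⁻ F x))
        (trans (x∈p⇒suc∣p-x∣≡∣p∣ x∈F) ∣F∣)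

      H⊆F∪G : H ⊆ F ∪ G
      H⊆F∪G = ∪-least (p⊆p∪q G ∘ proj₁ ∘ x∈p-y⁻ F x) (q⊆p∪q F G ∘ ⁅x⁆⊆p b∈G)

      m∈F-x : value m ∈ F - x
      m∈F-x = x∈p∧x≢y⇒x∈p-y m∈F λ { refl → x∉ (q⊆p∪q (B - b) ⁅ value m ⁆ (x∈⁅x⁆ (value m))) }

    -- Up to size `d`, `star-cover` already puts `H` inside a facet. At size `suc d`, two distinct
    -- vertices `u` and `v` of `H` give facets `F` and `G` through `m` covering `H - u` and `H - v`.
    -- Either `F = G` contains `H`, or `H` lies in the union of two rivals.
    EClosed⇒simplicial : 1 ≤ d → Simplicial d Γ ⁅ value m ⁆
    EClosed⇒simplicial 1≤d = (λ v → closed Γ (q⊆p∪q ⁅ value m ⁆ ⁅ v ⁆)) , clique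
      where
      clique : ∀ k → k ≤ d → ∀ H → Lift (λ v → Star Γ ⁅ value m ⁆ ⁅ v ⁆) H →
        ∣ H ∣ ≡ suc k → Face Γ H
      clique k k≤d H H⊆star ∣H∣ with m≤n⇒m<n∨m≡n k≤d
      ... | inj₁ k<d with F , F∈Γ , _ , _ , H⊆F ← star-cover H ∣H∣ k<d H⊆star = closed Γ H⊆F F∈Γ
      ... | inj₂ refl
        with u , u∈H ← 0<∣p∣⇒Nonempty {p = H} (subst (0 <_) (sym ∣H∣) (s≤s z≤n))
        with ∣H-u∣ ← suc-injective (trans (x∈p⇒suc∣p-x∣≡∣p∣ u∈H) ∣H∣)
        -- A second vertex exists because `H - u` has `d ≥ 1` elements.
        with v , v∈H-u ← 0<∣p∣⇒Nonempty {p = H - u} (subst (0 <_) (sym ∣H-u∣) 1≤d)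
        with v∈H , v≢u ← x∈p-y⁻ H u v∈H-u
        with F , F∈Γ , ∣F∣ , m∈F , H-u⊆F ←
          star-cover (H - u) ∣H-u∣ ≤-refl (H⊆star ∘ proj₁ ∘ x∈p-y⁻ H u)
        with G , G∈Γ , ∣G∣ , m∈G , H-v⊆G ←
          star-cover (H - v) (suc-injective (trans (x∈p⇒suc∣p-x∣≡∣p∣ v∈H) ∣H∣)) ≤-refl
            (H⊆star ∘ proj₁ ∘ x∈p-y⁻ H v)
        with u∈G ← H-v⊆G (x∈p∧x≢y⇒x∈p-y u∈H (v≢u ∘ sym))
        with F ≟ˢ G
      ... | yes refl = closed Γ (p-x⊆q∧x∈q⇒p⊆q H-u⊆F u∈G) F∈Γ
      ... | no  F≢G  = e-closed (top⇒rivals Γ-pure m-top F∈Γ G∈Γ ∣F∣ ∣G∣ F≢G m∈F m∈G)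
        (p-x⊆q∧x∈q⇒p⊆q (p⊆p∪q G ∘ H-u⊆F) (q⊆p∪q F G u∈G)) ∣H∣

    -- Faces of the deletion avoid `m`, hence so does every `H` inside `F ∪ G`, and `full-abdel⁺`
    -- applies.
    EClosed-abdel : EClosed (abdel ⁅ value m ⁆ Γ)
    EClosed-abdel {F} {G} r H⊆F∪G ∣H∣ =
      full-abdel⁺ Γ-pure (e-closed (Rivals-abdel⁻ r) H⊆F∪G ∣H∣) ∣H∣ (x∈⁅x⁆ (value m))
        ([ x∉abdel-⁅x⁆ {Γ = Γ} F∈Γ , x∉abdel-⁅x⁆ {Γ = Γ} G∈Γ ]′ ∘ x∈p∪q⁻ F G ∘ H⊆F∪G)
      where open Rivals r

  EClosed⇒reducible : 1 ≤ d → ∀ {Γ} → PureSub d Δ Γ → EClosed Γ → Reducible d 0 Γ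
  EClosed⇒reducible 1≤d = reducible EClosed λ {_} {m} Γ-pure m-top e-closed →
    ⁅ value m ⁆ , proj₁ m-top , ∣⁅x⁆∣≡1 (value m) ,
    EClosed⇒simplicial Γ-pure m-top e-closed 1≤d ,
    EClosed-abdel Γ-pure m-top e-closed

  -- Mid-chordal complexes

  MidClosed : SimplicialComplex n → Set
  MidClosed Γ = ∀ {F G m} → Rivals Γ F G m → ∀ {e} → e ⊆ (F ∪ G) - value m → ∣ e ∣ ≡ 2 →
    ∃[ H ] Face Γ H × ∣ H ∣ ≡ suc d × e ⊆ H × H ⊆ (F ∪ G) - value m

  module _ {Γ : SimplicialComplex n} (Γ-pure : PureSub d Δ Γ)
           {m : Vertex Δ} (m-top : Top Γ m) (mid-closed : MidClosed Γ) where

    -- Take a facet `F` through `m` and `u`, and a facet `G` through `m` and `v`. If neither `v ∈ F`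
    -- nor `u = m`, then `F` and `G` are rivals and `u`, `v` form a two-element set avoiding `m`, so
    -- some `H` contains both.
    MidClosed⇒simplicial : Simplicial 1 Γ ⁅ value m ⁆
    MidClosed⇒simplicial = clique₁ Γ edge
      where
      edge : ∀ {u v} → Star Γ ⁅ value m ⁆ ⁅ u ⁆ → Star Γ ⁅ value m ⁆ ⁅ v ⁆ →
        Face Γ (⁅ u ⁆ ∪ ⁅ v ⁆)
      edge {u} {v} mu∈Γ mv∈Γ
        with F , F∈Γ , ∣F∣ , mu⊆F ← extend Γ-pure mu∈Γ
        with G , G∈Γ , ∣G∣ , mv⊆G ← extend Γ-pure mv∈Γ
        with u∈F ← mu⊆F (y∈⁅x⁆∪⁅y⁆ (value m) u)
        with v∈G ← mv⊆G (y∈⁅x⁆∪⁅y⁆ (value m) v)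
        with m∈F ← mu⊆F (x∈⁅x⁆∪⁅y⁆ (value m) u)
        with m∈G ← mv⊆G (x∈⁅x⁆∪⁅y⁆ (value m) v)
        with v ∈? F
      ... | yes v∈F = closed Γ (⁅x⁆∪⁅y⁆⊆p u∈F v∈F) F∈Γ
      ... | no  v∉F
        with u Fin.≟ value m
      ... | yes refl = closed Γ (⁅x⁆∪⁅y⁆⊆p m∈G v∈G) G∈Γ
      ... | no  u≢m
        with H , H∈Γ , _ , uv⊆H , _ ← mid-closed
               (top⇒rivals Γ-pure m-top F∈Γ G∈Γ ∣F∣ ∣G∣ (λ { refl → v∉F v∈G }) m∈F m∈G)
               (⁅x⁆∪⁅y⁆⊆p (x∈p∧x≢y⇒x∈p-y (p⊆p∪q G u∈F) u≢m)
                          (x∈p∧x≢y⇒x∈p-y (q⊆p∪q F G v∈G) λ { refl → v∉F m∈F }))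
               (trans (x∉p⇒∣p∪⁅x⁆∣≡suc∣p∣ {x = v} {p = ⁅ u ⁆} (x≢y⇒x∉⁅y⁆ λ { refl → v∉F u∈F }))
                      (cong suc (∣⁅x⁆∣≡1 u)))
        = closed Γ uv⊆H H∈Γ

    MidClosed-abdel : MidClosed (abdel ⁅ value m ⁆ Γ)
    MidClosed-abdel {F} {G} {m′} r e⊆ ∣e∣
      with H , H∈Γ , ∣H∣ , e⊆H , H⊆ ← mid-closed (Rivals-abdel⁻ r) e⊆ ∣e∣
      = H , full-abdel⁺ Γ-pure H∈Γ ∣H∣ (x∈⁅x⁆ (value m))
          ([ x∉abdel-⁅x⁆ {Γ = Γ} F∈Γ , x∉abdel-⁅x⁆ {Γ = Γ} G∈Γ ]′
            ∘ x∈p∪q⁻ F G ∘ proj₁ ∘ x∈p-y⁻ (F ∪ G) (value m′) ∘ H⊆) ,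
        ∣H∣ , e⊆H , H⊆
      where open Rivals r

  MidClosed⇒reducible : ∀ {Γ} → PureSub d Δ Γ → MidClosed Γ → Reducible 1 0 Γ
  MidClosed⇒reducible = reducible MidClosed λ {_} {m} Γ-pure m-top mid-closed →
    ⁅ value m ⁆ , proj₁ m-top , ∣⁅x⁆∣≡1 (value m) ,
    MidClosed⇒simplicial Γ-pure m-top mid-closed ,
    MidClosed-abdel Γ-pure m-top mid-closed

  -- Very-weakly-chordal complexes

  VeryWeaklyClosed : SimplicialComplex n → Set
  VeryWeaklyClosed Γ = ∀ {F G m} → Rivals Γ F G m → Adjacent F G →
    Face Γ ((F ∪ G) - value m)

  -- The dimension of `Γ` bounds the size from above. From below, `F - m` has `d` elements and omits
  -- a vertex of `G` outside `F`, which exists since `F` and `G` differ and have equal size. The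
  -- exact size is what `full-abdel⁺` requires.
  rivals⇒∣F∪G-m∣ : ∀ {Γ F G m} → PureSub d Δ Γ → Rivals Γ F G m →
    Face Γ ((F ∪ G) - value m) → ∣ (F ∪ G) - value m ∣ ≡ suc d
  rivals⇒∣F∪G-m∣ {F = F} {G} {m} Γ-pure r H∈Γ = ≤-antisym (bounded Γ-pure _ H∈Γ)
      (subst (_≤ ∣ (F ∪ G) - value m ∣) (trans (x∈p⇒suc∣p-x∣≡∣p∣ m∈F) ∣F∣)
        (p⊂q⇒∣p∣<∣q∣ F-m⊂H))
    where
    open Rivals r
    m∈F = proj₁ maxF

    G⊈F : G ⊈ F
    G⊈F G⊆F = F≢G (sym (p⊆q∧∣q∣≤∣p∣⇒p≡q G⊆F (≤-reflexive (trans ∣F∣ (sym ∣G∣)))))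

    F-m⊂H : F - value m ⊂ (F ∪ G) - value m
    F-m⊂H with x , x∈G , x∉F ← p⊈q⇒∃ G⊈F =
      (λ y∈F-m → let y∈F , y≢m = x∈p-y⁻ F (value m) y∈F-m in
        x∈p∧x≢y⇒x∈p-y (p⊆p∪q G y∈F) y≢m) ,
      x , x∈p∧x≢y⇒x∈p-y (q⊆p∪q F G x∈G) (λ { refl → x∉F m∈F }) ,
      x∉F ∘ proj₁ ∘ x∈p-y⁻ F (value m)

  module _ {Γ : SimplicialComplex n} (Γ-pure : PureSub d Δ Γ)
           {m : Vertex Δ} (m-top : Top Γ m) (vw-closed : VeryWeaklyClosed Γ)
           {R : Subset n} (m∈R : value m ∈ R) where

    -- If `u` or `v` lies in `R`, or `u = v`, a single star face contains both. Otherwise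
    -- `R ∪ ⁅ u ⁆` and `R ∪ ⁅ v ⁆` are facets meeting in `R`, hence adjacent, and both contain `m`.
    -- Removing `m` from their union keeps `u` and `v`, since `m ∈ R`.
    VeryWeaklyClosed⇒simplicial : ∣ R ∣ ≡ d → Simplicial 1 Γ R
    VeryWeaklyClosed⇒simplicial ∣R∣ = clique₁ Γ edge
      where
      edge : ∀ {u v} → Star Γ R ⁅ u ⁆ → Star Γ R ⁅ v ⁆ → Face Γ (⁅ u ⁆ ∪ ⁅ v ⁆)
      edge {u} {v} F∈Γ G∈Γ with u ∈? R | v ∈? R | u Fin.≟ v
      ... | yes u∈R | _ | _ =
        closed Γ (⁅x⁆∪⁅y⁆⊆p (p⊆p∪q ⁅ v ⁆ u∈R) (q⊆p∪q R ⁅ v ⁆ (x∈⁅x⁆ v))) G∈Γ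
      ... | no _ | yes v∈R | _ =
        closed Γ (⁅x⁆∪⁅y⁆⊆p (q⊆p∪q R ⁅ u ⁆ (x∈⁅x⁆ u)) (p⊆p∪q ⁅ u ⁆ v∈R)) F∈Γ
      ... | no _ | no _ | yes refl =
        closed Γ (⁅x⁆∪⁅y⁆⊆p (q⊆p∪q R ⁅ u ⁆ (x∈⁅x⁆ u)) (q⊆p∪q R ⁅ u ⁆ (x∈⁅x⁆ u))) F∈Γ
      ... | no u∉R | no v∉R | no u≢v =
        closed Γ (⁅x⁆∪⁅y⁆⊆p
            (x∈p∧x≢y⇒x∈p-y (p⊆p∪q G u∈F) (λ { refl → u∉R m∈R }))
            (x∈p∧x≢y⇒x∈p-y (q⊆p∪q F G (q⊆p∪q R ⁅ v ⁆ (x∈⁅x⁆ v))) (λ { refl → v∉R m∈R })))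
          (vw-closed
            (top⇒rivals Γ-pure m-top F∈Γ G∈Γ ∣F∣ ∣G∣ (λ F≡G → u∉G (subst (u ∈_) F≡G u∈F))
              (p⊆p∪q ⁅ u ⁆ m∈R) (p⊆p∪q ⁅ v ⁆ m∈R))
            (trans ∣F∣ (sym ∣G∣) , trans (cong suc ∣F∩G∣) (sym ∣F∣)))
        where
        F = R ∪ ⁅ u ⁆
        G = R ∪ ⁅ v ⁆

        ∣F∣ : ∣ F ∣ ≡ suc d
        ∣F∣ = trans (x∉p⇒∣p∪⁅x⁆∣≡suc∣p∣ u∉R) (cong suc ∣R∣)

        ∣G∣ : ∣ G ∣ ≡ suc d
        ∣G∣ = trans (x∉p⇒∣p∪⁅x⁆∣≡suc∣p∣ v∉R) (cong suc ∣R∣)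

        u∈F : u ∈ F
        u∈F = q⊆p∪q R ⁅ u ⁆ (x∈⁅x⁆ u)

        u∉G : u ∉ G
        u∉G = [ u∉R , x≢y⇒x∉⁅y⁆ u≢v ]′ ∘ x∈p∪q⁻ R ⁅ v ⁆

        ∣F∩G∣ : ∣ F ∩ G ∣ ≡ d
        ∣F∩G∣ = ≤-antisym
          (≤-pred (subst (∣ F ∩ G ∣ <_) ∣F∣
            (p⊂q⇒∣p∣<∣q∣ (p∩q⊆p F G , u , u∈F , u∉G ∘ p∩q⊆q F G))))
          (subst (_≤ ∣ F ∩ G ∣) ∣R∣
            (p⊆q⇒∣p∣≤∣q∣ {p = R} λ x∈R → x∈p∩q⁺ (p⊆p∪q ⁅ u ⁆ x∈R , p⊆p∪q ⁅ v ⁆ x∈R)))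

    -- Unlike after deleting a vertex, `F` or `G` may still contain `m`. But then `m` is their
    -- common maximum `m′`, the very vertex removed from the union. So the new face avoids `m` in
    -- every case and cannot contain `R`.
    VeryWeaklyClosed-abdel : VeryWeaklyClosed (abdel R Γ)
    VeryWeaklyClosed-abdel {F} {G} {m′} r adjacent =
      full-abdel⁺ Γ-pure H∈Γ (rivals⇒∣F∪G-m∣ Γ-pure r′ H∈Γ) m∈R m∉H
      where
      r′ : Rivals Γ F G m′
      r′ = Rivals-abdel⁻ r
      open Rivals r′

      H∈Γ : Face Γ ((F ∪ G) - value m′)
      H∈Γ = vw-closed r′ adjacent

      m∉H : value m ∉ (F ∪ G) - value m′
      m∉H m∈H with m∈F∪G , m≢m′ ← x∈p-y⁻ (F ∪ G) (value m′) m∈H =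
        m≢m′ (cong value ([ top∈max⇒≡ Γ-pure m-top F∈Γ maxF , top∈max⇒≡ Γ-pure m-top G∈Γ maxG ]′
          (x∈p∪q⁻ F G m∈F∪G)))

  VeryWeaklyClosed⇒reducible : 1 ≤ d → ∀ {Γ} → PureSub d Δ Γ → VeryWeaklyClosed Γ →
    Reducible 1 (d ∸ 1) Γ
  VeryWeaklyClosed⇒reducible 1≤d = reducible VeryWeaklyClosed step
    where
    -- The ridge is a facet through `m` minus some other vertex `x`. The top vertex is chosen afresh
    -- each time, so `m` recurs until no facet contains it.
    step : ∀ {Γ m} → PureSub d Δ Γ → Top Γ m → VeryWeaklyClosed Γ →
      ∃[ R ] Face Γ R × ∣ R ∣ ≡ suc (d ∸ 1) × Simplicial 1 Γ R × VeryWeaklyClosed (abdel R Γ)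
    step {Γ} {m} Γ-pure m-top vw-closed
      with F , F∈Γ , ∣F∣ , m⊆F ← extend Γ-pure (proj₁ m-top)
      with m∈F ← m⊆F (x∈⁅x⁆ (value m))
      -- `F - m` has `d` elements, so `1≤d` provides `x`.
      with x , x∈F-m ← 0<∣p∣⇒Nonempty {p = F - value m} (subst (0 <_)
             (sym (suc-injective (trans (x∈p⇒suc∣p-x∣≡∣p∣ m∈F) ∣F∣))) 1≤d)
      with x∈F , x≢m ← x∈p-y⁻ F (value m) x∈F-m
      with ∣R∣ ← suc-injective (trans (x∈p⇒suc∣p-x∣≡∣p∣ x∈F) ∣F∣)
      with m∈R ← x∈p∧x≢y⇒x∈p-y m∈F (x≢m ∘ sym)
      = F - x , closed Γ (proj₁ ∘ x∈p-y⁻ F x) F∈Γ , trans ∣R∣ (sym (m+[n∸m]≡n 1≤d)) ,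
        VeryWeaklyClosed⇒simplicial Γ-pure m-top vw-closed m∈R ∣R∣ ,
        VeryWeaklyClosed-abdel Γ-pure m-top vw-closed m∈R

theorem4 : ∀ (n d : ℕ) (Δ : SimplicialComplex n) → 1 ≤ d → Pure Δ → HasDim d Δ →
    (EChordal Δ → VertexChordal d Δ) ×
    (MidChordal Δ → WeaklyVertexChordal d Δ) ×
    (VeryWeaklyChordal Δ → WeaklyRidgeChordal d Δ)
theorem4 n d Δ 1≤d pure dim =
  (λ { (ℓ , chordal) → 1≤d , dim , EClosed⇒reducible ℓ 1≤d Δ-pure
    λ { {F} {G} {m} r H⊆ ∣H∣ → let open Rivals r in
      chordal F G (facet F∈Γ ∣F∣) (facet G∈Γ ∣G∣) F≢G (trans ∣F∣ (sym ∣G∣)) m maxF maxG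
        _ H⊆ (trans ∣H∣ (sym ∣F∣)) } }) ,
  (λ { (ℓ , chordal) → 1≤d , dim , MidClosed⇒reducible ℓ Δ-pure
    λ { {F} {G} {m} r e⊆ ∣e∣ → let open Rivals r in
      let _ , H , H∈Δ , ∣H∣ , e⊆H , H⊆ =
            chordal F G (facet F∈Γ ∣F∣) (facet G∈Γ ∣G∣) F≢G (trans ∣F∣ (sym ∣G∣)) m maxF maxG
              _ e⊆ ∣e∣
      in H , H∈Δ , trans ∣H∣ ∣F∣ , e⊆H , H⊆ } }) ,
  -- The first component reads `d ∸ 1 < d ∸ 0`, whose right side computes to `d`.
  (λ { (ℓ , chordal) → ∸-monoʳ-< (s≤s z≤n) 1≤d , dim , VeryWeaklyClosed⇒reducible ℓ 1≤d Δ-pure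
    λ { {F} {G} {m} r adjacent → let open Rivals r in
      chordal F G (facet F∈Γ ∣F∣) (facet G∈Γ ∣G∣) F≢G adjacent (trans ∣F∣ (sym ∣G∣)) m maxF maxG } })
  where
  Δ-pure : PureSub d Δ Δ
  Δ-pure = pure⇒PureSub pure dim

  facet : ∀ {F} → Face Δ F → ∣ F ∣ ≡ suc d → Facet Δ F
  facet = full⇒facet Δ-pure
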